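{- Let $q$ and $k$ be fixed positive integers. Let $\mathcal{A}$ be the set of all (isomorphism classes of) $k$-vertex graphs $H$ with $\omega(H) < q$ and $\chi(H) \geq 5$. For each $H \in \mathcal{A}$ let $\mathcal{M}(H)$ be the family of all subsets $M \subseteq V(H)$ such that (a) the induced subgraph $H[M]$ contains no $K_{q-1}$; (b) $M \not\subseteq N_H(v)$ for every $v \in V(H)$; (c) $M$ is a marked vertex set in $H$. For each $H \in \mathcal{A}$ and each nonempty minimal complete subfamily $\{M_{i_1}, \dots, M_{i_s}\}$ of $\mathcal{M}(H)$, form the graph $G(M_{i_1},\dots,M_{i_s})$ by adding to $H$ new pairwise non-adjacent vertices $v_1,\dots,v_s$ with the neighborhood of $v_j$ equal to $M_{i_j}$, $j = 1,\dots,s$. Let $\mathcal{B}$ be the set of all graphs so formed, after keeping one graph from each isomorphism class and then removing all graphs which are not minimal $(3,3)$-Ramsey graphs. Then, up to isomorphism, $\mathcal{B}$ coincides with the set of all minimal $(3,3)$-Ramsey graphs $G$ for which $\omega(G) < q$ and $\alpha(G) \geq |V(G)| - k \geq 1$.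
   Context: All graphs are finite, undirected, without loops or multiple edges. $\omega,\alpha,\chi$ denote clique, independence and chromatic number; $N_H(v)$ is the set of vertices of $H$ adjacent to $v$. A graph $G$ is a $(3,3)$-Ramsey graph, written $G \rightarrow (3,3)$, if every 2-coloring of its edges contains a monochromatic triangle. $G$ is a minimal $(3,3)$-Ramsey graph if $G \rightarrow (3,3)$ and no proper subgraph $H$ of $G$ satisfies $H \rightarrow (3,3)$. A 2-coloring of the edges of a graph is $(3,3)$-free if it has no monochromatic triangle. For $M \subseteq V(H)$ let $H_M$ be the graph obtained from $H$ by adding a new vertex whose set of neighbors is $M$. $M$ is a marked vertex set in $H$ if there is a $(3,3)$-free 2-coloring of the edges of $H$ which cannot be extended to a $(3,3)$-free 2-coloring of the edges of $H_M$. A family $\{M_1,\dots,M_s\}$ of marked vertex sets in $H$ is complete if for each $(3,3)$-free 2-coloring of the edges of $H$ there is $i \in \{1,\dots,s\}$ such that this coloring cannot be extended to a $(3,3)$-free 2-coloring of the edges of $H_{M_i}$. A complete family is minimal if it contains no proper complete subfamily. -}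

module Defs where

open import Data.Bool using (Bool; true; false; T)
open import Data.Bool.Properties using (T?)
open import Data.Fin using (Fin; finToFun; funToFin)
open import Data.Fin.Properties using (_≟_; all?; any?; finToFun-funToFin)
open import Data.Fin.Subset using (Subset; _∈_; _⊈_; _⊂_; ⊤)
open import Data.List using (filter; upTo)
open import Data.List.Extrema.Nat using (max; min)
open import Data.Nat using (ℕ; suc; pred; _≤_; _<_; _≥_)
open import Data.Product using (Σ; ∃; ∃-syntax; _×_; _,_; proj₁; proj₂)
open import Data.Sum using (_⊎_; inj₁; inj₂)
open import Data.Unit using () renaming (⊤ to 𝟙)
open import Data.Vec using (lookup; tabulate)
open import Function.Bundles using (_↔_; Inverse)
open import Function.Definitions using (Injective)
open import Relation.Binary.PropositionalEquality
  using (_≡_; _≢_; _≗_; refl; sym; subst; subst₂)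
open import Relation.Nullary using (¬_; Dec; contradiction)
open import Relation.Nullary.Decidable using (map′; ¬?; _×-dec_; _→-dec_)

private
  variable
    V W J : Set
    n k : ℕ

------------------------------------------------------------------------
-- Graphs

-- Loopless simple graphs on a vertex type V.  Finiteness is not part of the
-- record: it comes from V, which is Fin n or built from such types.
record Graph (V : Set) : Set where
  field
    adj        : V → V → Bool
    adj-sym    : ∀ u v → adj u v ≡ adj v u
    adj-irrefl : ∀ v → adj v v ≡ false

  Adj : V → V → Set
  Adj u v = T (adj u v)

open Graph public

infix 4 _≅_

record _≅_ (G : Graph V) (H : Graph W) : Set where
  field
    bij      : V ↔ W
    adj-pres : ∀ u v → adj G u v ≡ adj H (Inverse.to bij u) (Inverse.to bij v)

record Subgraph (G : Graph V) : Set where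
  field
    inV     : V → Bool
    inE     : V → V → Bool
    inE-sym : ∀ u v → inE u v ≡ inE v u
    inE⊆    : ∀ u v → T (inE u v) → T (inV u) × T (inV v) × Adj G u v

  Proper : Set
  Proper = (∃[ v ] ¬ T (inV v)) ⊎ (∃[ u ] ∃[ v ] Adj G u v × ¬ T (inE u v))

  private
    irr : ∀ b {u} → inE u u ≡ b → b ≡ false
    irr false     _ = refl
    irr true  {u} e = contradiction
      (subst T (adj-irrefl G u)
               (proj₂ (proj₂ (inE⊆ u u (subst T (sym e) _)))))
      (λ ())

  toGraph : Graph (Σ V (λ v → T (inV v)))
  toGraph = record
    { adj        = λ u v → inE (proj₁ u) (proj₁ v)
    ; adj-sym    = λ u v → inE-sym (proj₁ u) (proj₁ v)
    ; adj-irrefl = λ v → irr (inE (proj₁ v) (proj₁ v)) refl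
    }

infix 8 _[_]

-- Induced subgraph.
_[_] : Graph (Fin n) → (M : Subset n) → Graph (∃[ v ] v ∈ M)
H [ M ] = record
  { adj        = λ u v → adj H (proj₁ u) (proj₁ v)
  ; adj-sym    = λ u v → adj-sym H (proj₁ u) (proj₁ v)
  ; adj-irrefl = λ v → adj-irrefl H (proj₁ v)
  }

N : Graph (Fin n) → Fin n → Subset n
N H v = tabulate (adj H v)

-- Add pairwise non-adjacent new vertices, one for each j : J, the new vertex j
-- having neighbourhood M j.
addVertices : Graph (Fin n) → (J → Subset n) → Graph (Fin n ⊎ J)
addVertices {n = n} {J = J} H M = record
  { adj = a ; adj-sym = a-sym ; adj-irrefl = a-irrefl }
  where
  a : Fin n ⊎ J → Fin n ⊎ J → Bool
  a (inj₁ u) (inj₁ v) = adj H u v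
  a (inj₁ u) (inj₂ j) = lookup (M j) u
  a (inj₂ i) (inj₁ v) = lookup (M i) v
  a (inj₂ i) (inj₂ j) = false

  a-sym : ∀ x y → a x y ≡ a y x
  a-sym (inj₁ u) (inj₁ v) = adj-sym H u v
  a-sym (inj₁ u) (inj₂ j) = refl
  a-sym (inj₂ i) (inj₁ v) = refl
  a-sym (inj₂ i) (inj₂ j) = refl

  a-irrefl : ∀ x → a x x ≡ false
  a-irrefl (inj₁ u) = adj-irrefl H u
  a-irrefl (inj₂ j) = refl

-- H_M: one new vertex.
addVertex : Graph (Fin n) → Subset n → Graph (Fin n ⊎ 𝟙)
addVertex H M = addVertices H (λ _ → M)

------------------------------------------------------------------------
-- Clique, independence and chromatic numbers

-- G contains K_r.  The r vertices are automatically distinct, as G has no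
-- loops.
ContainsK : ℕ → Graph V → Set
ContainsK {V = V} r G = Σ (Fin r → V) λ f → ∀ i j → i ≢ j → Adj G (f i) (f j)

-- G has r distinct pairwise non-adjacent vertices.
HasIndependent : ℕ → Graph V → Set
HasIndependent {V = V} r G =
  Σ (Fin r → V) λ f → Injective _≡_ _≡_ f × (∀ i j → ¬ Adj G (f i) (f j))

Colourable : ℕ → Graph V → Set
Colourable {V = V} r G =
  Σ (V → Fin r) λ f → ∀ u v → Adj G u v → f u ≢ f v

anyFun? : ∀ {a b} {P : (Fin a → Fin b) → Set} →
          (∀ {f g} → f ≗ g → P f → P g) → (∀ f → Dec (P f)) → Dec (∃ P)
anyFun? resp P? = map′
  (λ (c , p) → finToFun c , p)
  (λ (f , p) → funToFin f , resp (λ i → sym (finToFun-funToFin f i)) p)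
  (any? (λ c → P? (finToFun c)))

containsK? : (G : Graph (Fin n)) → ∀ r → Dec (ContainsK r G)
containsK? G r = anyFun?
  (λ f≗g p i j i≢j → subst₂ (Adj G) (f≗g i) (f≗g j) (p i j i≢j))
  (λ f → all? λ i → all? λ j → ¬? (i ≟ j) →-dec T? (adj G (f i) (f j)))

hasIndependent? : (G : Graph (Fin n)) → ∀ r → Dec (HasIndependent r G)
hasIndependent? G r = anyFun?
  (λ f≗g (inj , p) →
      (λ {i} {j} e → inj (subst₂ _≡_ (sym (f≗g i)) (sym (f≗g j)) e))
    , (λ i j → subst₂ (λ x y → ¬ Adj G x y) (f≗g i) (f≗g j) (p i j)))
  (λ f → map′ (λ h {i} {j} → h i j) (λ h i j → h {i} {j})
           (all? λ i → all? λ j → (f i ≟ f j) →-dec (i ≟ j))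
         ×-dec (all? λ i → all? λ j → ¬? (T? (adj G (f i) (f j)))))

colourable? : (G : Graph (Fin n)) → ∀ r → Dec (Colourable r G)
colourable? G r = anyFun?
  (λ f≗g p u v e → subst₂ _≢_ (f≗g u) (f≗g v) (p u v e))
  (λ f → all? λ u → all? λ v → T? (adj G u v) →-dec ¬? (f u ≟ f v))

-- The searches over 0, …, n lose nothing: a graph on n vertices has no clique
-- or independent set with more than n vertices, and it is n-colourable (so the
-- default value n of the minimum is harmless).
ω : Graph (Fin n) → ℕ
ω {n = n} G = max 0 (filter (containsK? G) (upTo (suc n)))

α : Graph (Fin n) → ℕ
α {n = n} G = max 0 (filter (hasIndependent? G) (upTo (suc n)))

χ : Graph (Fin n) → ℕ
χ {n = n} G = min n (filter (colourable? G) (upTo (suc n)))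

------------------------------------------------------------------------
-- (3,3)-Ramsey graphs

-- Only the values on edges of G are constrained or ever used.
record EdgeColouring (G : Graph V) : Set where
  field
    colour     : V → V → Bool
    colour-sym : ∀ u v → Adj G u v → colour u v ≡ colour v u

open EdgeColouring public

MonoTriangle : {G : Graph V} → EdgeColouring G → Set
MonoTriangle {G = G} c = ∃[ u ] ∃[ v ] ∃[ w ]
  Adj G u v × Adj G v w × Adj G u w ×
  colour c u v ≡ colour c v w × colour c v w ≡ colour c u w

Free : {G : Graph V} → EdgeColouring G → Set
Free c = ¬ MonoTriangle c

Ramsey : Graph V → Set
Ramsey G = (c : EdgeColouring G) → MonoTriangle c

MinimalRamsey : Graph V → Set
MinimalRamsey G =
  Ramsey G × ((F : Subgraph G) → Subgraph.Proper F → ¬ Ramsey (Subgraph.toGraph F))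

------------------------------------------------------------------------
-- Marked vertex sets and complete families

Extendable : {H : Graph (Fin k)} → EdgeColouring H → Subset k → Set
Extendable {H = H} c M = Σ (EdgeColouring (addVertex H M)) λ d →
  (∀ u v → Adj H u v → colour d (inj₁ u) (inj₁ v) ≡ colour c u v) × Free d

Marked : Graph (Fin k) → Subset k → Set
Marked H M = Σ (EdgeColouring H) λ c → Free c × ¬ Extendable c M

Complete : Graph (Fin k) → (J → Subset k) → Set
Complete H M =
  (∀ j → Marked H (M j)) ×
  ((c : EdgeColouring H) → Free c → ∃[ j ] ¬ Extendable c (M j))

-- For a family of distinct sets, its proper subfamilies correspond to the
-- proper subsets I of the index set.
MinimalComplete : ∀ {s} → Graph (Fin k) → (Fin s → Subset k) → Set
MinimalComplete {s = s} H M =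
  Complete H M ×
  ((I : Subset s) → I ⊂ ⊤ →
    ¬ Complete {J = ∃[ i ] i ∈ I} H (λ (i , _) → M i))

------------------------------------------------------------------------
-- The sets 𝒜, ℳ(H) and ℬ

𝒜 : ℕ → Graph (Fin k) → Set
𝒜 q H = ω H < q × χ H ≥ 5

-- pred q is q - 1, as q is positive.
ℳ : ℕ → Graph (Fin k) → Subset k → Set
ℳ q H M =
  ¬ ContainsK (pred q) (H [ M ]) ×
  (∀ v → M ⊈ N H v) ×
  Marked H M

-- A graph H in 𝒜 with a nonempty minimal complete subfamily {M₁, …, M_s} of
-- ℳ(H), listed without repetition.
record Datum (q k : ℕ) : Set where
  field
    H        : Graph (Fin k)
    H∈𝒜      : 𝒜 q H
    s        : ℕ
    nonempty : 1 ≤ s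
    M        : Fin s → Subset k
    distinct : Injective _≡_ _≡_ M
    M∈ℳ      : ∀ j → ℳ q H (M j)
    minimal  : MinimalComplete H M

  formed : Graph (Fin k ⊎ Fin s)
  formed = addVertices H M

-- ℬ as a set of isomorphism classes: G belongs to it when G is isomorphic to
-- one of the formed graphs that survive the removal step.
ℬ : ℕ → ℕ → Graph V → Set
ℬ q k G = Σ (Datum q k) λ D → G ≅ Datum.formed D × MinimalRamsey (Datum.formed D)

{-# OPTIONS --safe #-}
-- Remove an independent set of n - k vertices from G and let H be the rest.
-- If H were 4-colourable, G would map homomorphically to K₅ and inherit the
-- pentagon colouring of K₅, which has no monochromatic triangle.  Every
-- triangle of G contains at most one removed vertex, so a colouring of H extends
-- to G as soon as it extends to each removed vertex separately: the
-- neighbourhoods of the removed vertices form a complete family exactly when G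
-- is Ramsey.  Everything else follows from one fact: no Ramsey graph maps
-- homomorphically to a minimal Ramsey graph while missing a vertex.
module Submission where

open import Defs
open import Data.Fin using (Fin)
open import Data.Nat using (ℕ; _≤_; _<_; _≥_; _∸_)
open import Data.Product using (_×_)
open import Function.Bundles using (_⇔_)

open import Data.Bool using (Bool; false; T; _∧_; _∨_)
open import Data.Bool.Properties using (T?; T-≡; T-∧; ¬-not; ∧-comm; ∧-idem)
import Data.Bool.Properties as Bool
open import Data.Fin using (zero; suc; toℕ; inject≤; punchIn; punchOut; combine; remQuot; _↑ˡ_)
open import Data.Fin.Permutation using (Permutation′; insert; insert-punchIn; _⟨$⟩ʳ_; ↔⇒≡)
import Data.Fin.Permutation as Perm
open import Data.Fin.Properties
  using (_≟_; any?; all?; inject≤-injective; injective⇒≤; punchIn-punchOut;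
         punchOut-injective; punchInᵢ≢i; punchIn-injective; remQuot-combine; ¬∀⟶∃¬; +↔⊎;
         suc-injective; 0≢1+n)
open import Data.Fin.Subset using (Subset; _∈_; _⊈_)
open import Data.Fin.Subset.Properties using (anySubset?)
open import Data.List using (upTo)
open import Data.List.Extrema.Nat using (xs≤max; max<v⁺; v≤min⁺; argmax-all)
import Data.List.Relation.Unary.All as All
open import Data.List.Relation.Unary.All.Properties using (all-filter)
open import Data.List.Membership.Propositional.Properties using (∈-filter⁺; ∈-upTo⁺)
open import Data.Nat using (zero; suc; _+_; s≤s)
open import Data.Nat.DivMod using (_%_)
import Data.Nat as ℕ
open import Data.Nat.Properties
  using (≰⇒>; <⇒≱; <⇒≤; m∸n+n≡m; m+n∸m≡n; m∸n≢0⇒n<m; >⇒≢)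
open import Data.Product using (Σ; ∃; ∃-syntax; _,_; proj₁; proj₂; uncurry)
open import Data.Sum using (_⊎_; inj₁; inj₂; [_,_]′)
open import Data.Sum.Algebra using (⊎-comm)
open import Data.Sum.Properties using (≡-dec; inj₂-injective)
open import Data.Unit using (tt) renaming (⊤ to 𝟙)
open import Data.Vec using (lookup; tabulate)
open import Data.Vec.Properties using (lookup∘tabulate; lookup⇒[]=; []=⇒lookup)
open import Function using (_∘_; id)
open import Function.Bundles using (_↔_; Injection; Inverse; Equivalence; mk⇔)
open import Function.Definitions using (Injective)
open import Function.Construct.Composition using (_↔-∘_)
open import Function.Construct.Symmetry using (↔-sym)
open import Function.Properties.Inverse using (↔⇒↣)
open import Relation.Binary.Definitions using (DecidableEquality)
open import Relation.Binary.PropositionalEquality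
  using (_≡_; _≢_; refl; sym; trans; cong; cong₂; subst; subst₂)
open import Relation.Nullary using (¬_; Dec; yes; no; contradiction; isNo)
open import Relation.Nullary.Decidable
  using (map′; ¬?; _×-dec_; _⊎-dec_; _→-dec_; decidable-stable; fromWitnessFalse;
         toWitnessFalse)

private
  variable
    V W J : Set
    n k s r r′ : ℕ

-- Homomorphisms

record Hom (G : Graph V) (F : Graph W) : Set where
  constructor hom
  field
    map  : V → W
    pres : ∀ u v → Adj G u v → Adj F (map u) (map v)

pullback : {G : Graph V} {F : Graph W} → Hom G F → EdgeColouring F → EdgeColouring G
pullback (hom φ pres) c = record
  { colour     = λ u v → colour c (φ u) (φ v)
  ; colour-sym = λ u v a → colour-sym c (φ u) (φ v) (pres u v a)
  }

push-triangle : {G : Graph V} {F : Graph W} (h : Hom G F) (c : EdgeColouring F) →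
                MonoTriangle (pullback h c) → MonoTriangle c
push-triangle (hom φ pres) _ (u , v , w , uv , vw , uw , e) =
  φ u , φ v , φ w , pres u v uv , pres v w vw , pres u w uw , e

Ramsey-hom : {G : Graph V} {F : Graph W} → Hom G F → Ramsey G → Ramsey F
Ramsey-hom h R c = push-triangle h c (R (pullback h c))

ContainsK-hom : {G : Graph V} {F : Graph W} → Hom G F → ContainsK r G → ContainsK r F
ContainsK-hom (hom φ pres) (f , clique) =
  φ ∘ f , λ i j i≢j → pres (f i) (f j) (clique i j i≢j)

irreflexive : (G : Graph V) → ∀ {v} → ¬ Adj G v v
irreflexive G {v} a = subst T (adj-irrefl G v) a

symmetric : (G : Graph V) → ∀ {u v} → Adj G u v → Adj G v u
symmetric G {u} {v} = subst T (adj-sym G u v)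

≅-sym : {G : Graph V} {F : Graph W} → G ≅ F → F ≅ G
≅-sym {F = F} e = record
  { bij      = ↔-sym bij
  ; adj-pres = λ u v → sym (trans (adj-pres (from u) (from v))
      (cong₂ (adj F) (strictlyInverseˡ u) (strictlyInverseˡ v)))
  }
  where
  open _≅_ e
  open Inverse bij

≅⇒Hom : {G : Graph V} {F : Graph W} → G ≅ F → Hom G F
≅⇒Hom e = hom (Inverse.to bij) λ u v → subst T (adj-pres u v)
  where open _≅_ e

-- A proper subgraph of `F` pulls back along the bijection to a proper subgraph of `G` into which it
-- maps homomorphically, so a Ramsey one would contradict the minimality of `G`.
MinimalRamsey-≅ : {G : Graph V} {F : Graph W} → G ≅ F → MinimalRamsey G → MinimalRamsey F
MinimalRamsey-≅ {G = G} {F = F} e (R , minimal) =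
  Ramsey-hom (≅⇒Hom e) R , λ S proper RS →
    minimal (preimage S) (preimage-proper S proper) (Ramsey-hom (lift S) RS)
  where
  open _≅_ e
  open Inverse bij

  preimage : Subgraph F → Subgraph G
  preimage S = record
    { inV     = λ v → inV (to v)
    ; inE     = λ u v → inE (to u) (to v)
    ; inE-sym = λ u v → inE-sym (to u) (to v)
    ; inE⊆    = λ u v uv → let pu , pv , a = inE⊆ (to u) (to v) uv in
                  pu , pv , subst T (sym (adj-pres u v)) a
    }
    where open Subgraph S

  preimage-proper : ∀ S → Subgraph.Proper S → Subgraph.Proper (preimage S)
  preimage-proper S (inj₁ (v , v∉)) =
    inj₁ (from v , λ p → v∉ (subst (T ∘ Subgraph.inV S) (strictlyInverseˡ v) p))
  preimage-proper S (inj₂ (u , v , uv , uv∉)) =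
    inj₂ (from u , from v , Hom.pres (≅⇒Hom (≅-sym e)) u v uv ,
          λ p → uv∉ (subst₂ (λ x y → T (Subgraph.inE S x y))
                            (strictlyInverseˡ u) (strictlyInverseˡ v) p))

  lift : ∀ S → Hom (Subgraph.toGraph S) (Subgraph.toGraph (preimage S))
  lift S = hom
    (λ (v , p) → from v , subst (T ∘ Subgraph.inV S) (sym (strictlyInverseˡ v)) p)
    λ (u , _) (v , _) → subst₂ (λ x y → T (Subgraph.inE S x y))
                               (sym (strictlyInverseˡ u)) (sym (strictlyInverseˡ v))

module _ (_≟ⱽ_ : DecidableEquality V) where

  delete : (G : Graph V) → V → Subgraph G
  delete G x = record
    { inV     = inV
    ; inE     = λ u v → adj G u v ∧ (inV u ∧ inV v)
    ; inE-sym = λ u v → cong₂ _∧_ (adj-sym G u v) (∧-comm (inV u) (inV v))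
    ; inE⊆    = λ u v uv → let a , p = Equivalence.to T-∧ uv
                               pu , pv = Equivalence.to T-∧ p in pu , pv , a
    }
    where
    inV : V → Bool
    inV u = isNo (u ≟ⱽ x)

  -- The image lies in `G` with `x` deleted, a proper subgraph that would inherit the Ramsey
  -- property from `F`.
  hom-surjective : {G : Graph V} {F : Graph W} → MinimalRamsey G → Ramsey F →
                   (h : Hom F G) → ∀ x → ¬ (∀ w → Hom.map h w ≢ x)
  hom-surjective {G = G} {F = F} (_ , minimal) RF (hom φ pres) x misses =
    minimal (delete G x) (inj₁ (x , λ p → toWitnessFalse p refl))
            (Ramsey-hom corestriction RF)
    where
    avoids : ∀ w → T (isNo (φ w ≟ⱽ x))
    avoids w = fromWitnessFalse (misses w)

    corestriction : Hom F (Subgraph.toGraph (delete G x))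
    corestriction = hom (λ w → φ w , avoids w) λ u v a →
      Equivalence.from T-∧ (pres u v a ,
        Equivalence.from (T-∧ {isNo (φ u ≟ⱽ x)}) (avoids u , avoids v))

  -- Otherwise folding v onto w is a homomorphism G → G missing v.
  no-dominated-vertex : {G : Graph V} → MinimalRamsey G → ∀ {v w} → v ≢ w →
                        ¬ (∀ u → Adj G v u → Adj G w u)
  no-dominated-vertex {G = G} min {v} {w} v≢w dom =
    hom-surjective min (proj₁ min) (hom fold fold-pres) v misses
    where
    fold : V → V
    fold x with x ≟ⱽ v
    ... | yes _ = w
    ... | no  _ = x

    misses : ∀ x → fold x ≢ v
    misses x with x ≟ⱽ v
    ... | yes _  = v≢w ∘ sym
    ... | no x≢v = x≢v

    fold-pres : ∀ x y → Adj G x y → Adj G (fold x) (fold y)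
    fold-pres x y a with x ≟ⱽ v | y ≟ⱽ v
    ... | yes refl | yes refl = contradiction a (irreflexive G)
    ... | yes refl | no _     = dom y a
    ... | no _     | yes refl = symmetric G (dom x (symmetric G a))
    ... | no _     | no _     = a

-- Exhaustive search over colourings

-- Constructively a triangle must be exhibited where an argument only refutes its absence; on such a
-- vertex type it can be found.
Searchable : Set → Set₁
Searchable V = {P : V → Set} → (∀ v → Dec (P v)) → Dec (∃ P)

any-⊎𝟙? : Searchable (Fin k ⊎ 𝟙)
any-⊎𝟙? P? = map′
  [ (λ (u , p) → inj₁ u , p) , (λ p → inj₂ tt , p) ]′
  (λ { (inj₁ u , p) → inj₁ (u , p) ; (inj₂ tt , p) → inj₂ p })
  (any? (P? ∘ inj₁) ⊎-dec P? (inj₂ tt))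

monoTriangle? : Searchable V → {G : Graph V} (c : EdgeColouring G) → Dec (MonoTriangle c)
monoTriangle? search {G} c = search λ u → search λ v → search λ w →
  T? (adj G u v) ×-dec T? (adj G v w) ×-dec T? (adj G u w) ×-dec
  (colour c u v Bool.≟ colour c v w) ×-dec (colour c v w Bool.≟ colour c u w)

-- Values off the edges are arbitrary, so colourings are compared on edges only.
_≐_ : {G : Graph V} → EdgeColouring G → EdgeColouring G → Set
_≐_ {G = G} c d = ∀ u v → Adj G u v → colour c u v ≡ colour d u v

Free-≐ : {G : Graph V} (c d : EdgeColouring G) → c ≐ d → Free d → Free c
Free-≐ _ _ c≐d free (u , v , w , uv , vw , uw , e , e′) = free
  (u , v , w , uv , vw , uw ,
   trans (sym (c≐d u v uv)) (trans e (c≐d v w vw)) ,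
   trans (sym (c≐d v w vw)) (trans e′ (c≐d u w uw)))

module _ {H : Graph (Fin k)} where

  Extendable-≐ : (c d : EdgeColouring H) {M : Subset k} →
                 c ≐ d → Extendable c M → Extendable d M
  Extendable-≐ _ _ c≐d (e , agrees , free) =
    e , (λ u v a → trans (agrees u v a) (c≐d u v a)) , free

  -- f u is the colour of the edge joining u to the new vertex.
  Compatible : EdgeColouring H → Subset k → (Fin k → Bool) → Set
  Compatible c M f = ∀ u v → T (lookup M u) → T (lookup M v) → Adj H u v →
                     ¬ (f u ≡ f v × f v ≡ colour c u v)

  glue : {M : J → Subset k} → EdgeColouring H → (J → Fin k → Bool) →
         EdgeColouring (addVertices H M)
  glue {J = J} {M = M} c f = record { colour = col ; colour-sym = col-sym }
    where
    col : Fin k ⊎ J → Fin k ⊎ J → Bool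
    col (inj₁ u) (inj₁ v) = colour c u v
    col (inj₁ u) (inj₂ j) = f j u
    col (inj₂ j) (inj₁ v) = f j v
    -- A placeholder: no edge joins two new vertices.
    col (inj₂ _) (inj₂ _) = false

    col-sym : ∀ x y → Adj (addVertices H M) x y → col x y ≡ col y x
    col-sym (inj₁ u) (inj₁ v) a = colour-sym c u v a
    col-sym (inj₁ u) (inj₂ j) _ = refl
    col-sym (inj₂ j) (inj₁ v) _ = refl
    col-sym (inj₂ i) (inj₂ j) _ = refl

  -- The missing clauses are absurd, since a triangle has at most one new vertex. Hence
  -- compatibility is needed for one `j` at a time.
  glue-free : {M : J → Subset k} (c : EdgeColouring H) (f : J → Fin k → Bool) →
              Free c → (∀ j → Compatible c (M j) (f j)) → Free (glue {M = M} c f)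
  glue-free _ _ free _ (inj₁ u , inj₁ v , inj₁ w , t) = free (u , v , w , t)
  glue-free _ _ _ ok (inj₁ u , inj₁ v , inj₂ j , uv , v∈ , u∈ , e , e′) =
    ok j u v u∈ v∈ uv (sym e′ , sym e)
  glue-free _ _ _ ok (inj₁ u , inj₂ j , inj₁ w , u∈ , w∈ , uw , e , e′) =
    ok j u w u∈ w∈ uw (e , e′)
  glue-free _ _ _ ok (inj₂ j , inj₁ v , inj₁ w , v∈ , vw , w∈ , e , e′) =
    ok j v w v∈ w∈ vw (trans e e′ , sym e′)

  Extendable⇒Free : (c : EdgeColouring H) (M : Subset k) → Extendable c M → Free c
  Extendable⇒Free _ _ (d , agrees , free) (u , v , w , uv , vw , uw , e , e′) = free
    (inj₁ u , inj₁ v , inj₁ w , uv , vw , uw ,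
     trans (agrees u v uv) (trans e (sym (agrees v w vw))) ,
     trans (agrees v w vw) (trans e′ (sym (agrees u w uw))))

  Extendable⇒Compatible : (c : EdgeColouring H) (M : Subset k) →
                          Extendable c M → ∃ (Compatible c M)
  Extendable⇒Compatible _ _ (d , agrees , free) =
    (λ u → colour d (inj₁ u) (inj₂ tt)) ,
    λ u v u∈ v∈ uv (e , e′) → free
      (inj₁ u , inj₁ v , inj₂ tt , uv , v∈ , u∈ , trans (agrees u v uv) (sym e′) , sym e)

  Compatible⇒Extendable : (c : EdgeColouring H) {M : Subset k} (f : Fin k → Bool) →
                          Free c → Compatible c M f → Extendable c M
  Compatible⇒Extendable c f free ok =
    glue c (λ _ → f) , (λ _ _ _ → refl) , glue-free c (λ _ → f) free (λ _ → ok)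

  compatible? : (c : EdgeColouring H) (M : Subset k) → ∀ f → Dec (Compatible c M f)
  compatible? c M f = all? λ u → all? λ v →
    T? (lookup M u) →-dec T? (lookup M v) →-dec T? (adj H u v) →-dec
    ¬? ((f u Bool.≟ f v) ×-dec (f v Bool.≟ colour c u v))

  -- Only the edges at the new vertex remain to be coloured, so the search runs over subsets of
  -- `Fin k`, read as the ends of the edges coloured `true`.
  extendable? : (c : EdgeColouring H) (M : Subset k) → Dec (Extendable c M)
  extendable? c M = map′
    (λ (free , S , ok) → Compatible⇒Extendable c (lookup S) free ok)
    (λ ext → Extendable⇒Free c M ext , toSubset (Extendable⇒Compatible c M ext))
    (¬? (monoTriangle? any? c) ×-dec anySubset? (λ S → compatible? c M (lookup S)))
    where
    toSubset : ∃ (Compatible c M) → ∃[ S ] Compatible c M (lookup S)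
    toSubset (f , ok) = tabulate f , λ u v u∈ v∈ uv (e , e′) → ok u v u∈ v∈ uv
      ( trans (sym (lookup∘tabulate f u)) (trans e (lookup∘tabulate f v))
      , trans (sym (lookup∘tabulate f v)) e′ )

  -- The conjunction makes every subset of k * k pairs symmetric, hence a
  -- colouring.
  decode : Subset (k ℕ.* k) → EdgeColouring H
  decode S = record
    { colour     = λ u v → lookup S (combine u v) ∧ lookup S (combine v u)
    ; colour-sym = λ u v _ → ∧-comm (lookup S (combine u v)) (lookup S (combine v u))
    }

  encode : EdgeColouring H → Subset (k ℕ.* k)
  encode c = tabulate (uncurry (colour c) ∘ remQuot k)

  decode-encode : (c : EdgeColouring H) → decode (encode c) ≐ c
  decode-encode c u v a = trans
    (cong₂ _∧_ (value u v) (trans (value v u) (sym (colour-sym c u v a))))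
    (∧-idem _)
    where
    value : ∀ u v → lookup (encode c) (combine u v) ≡ colour c u v
    value u v = trans (lookup∘tabulate _ (combine u v))
                      (cong (uncurry (colour c)) (remQuot-combine u v))

  -- Up to agreement on edges every colouring is some `decode S`, which leaves finitely many cases.
  -- Decidability lets markedness be proved by contradiction.
  marked? : (M : Subset k) → Dec (Marked H M)
  marked? M = map′
    (λ (S , p) → decode S , p)
    (λ (c , free , ¬ext) → encode c ,
      Free-≐ (decode (encode c)) c (decode-encode c) free ,
      ¬ext ∘ Extendable-≐ (decode (encode c)) c (decode-encode c))
    (anySubset? λ S → ¬? (monoTriangle? any? (decode S)) ×-dec ¬? (extendable? (decode S) M))

-- Completeness and the Ramsey property

  -- For finite families, this half of `Complete` is equivalent to the Ramsey property of
  -- `addVertices H M`.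
  Blocking : (J → Subset k) → Set
  Blocking M = (c : EdgeColouring H) → Free c → ∃[ j ] ¬ Extendable c (M j)

  old-vertices : {M : J → Subset k} → Hom H (addVertices H M)
  old-vertices = hom inj₁ λ _ _ → id

  -- An inclusion `ι` handles subfamilies; a constant `ι` maps a single `addVertex H (M j)` into the
  -- whole graph.
  reindex : {I : Set} {M : J → Subset k} (ι : I → J) →
            Hom (addVertices H (M ∘ ι)) (addVertices H M)
  reindex {J = J} {I = I} {M = M} ι = hom φ pres
    where
    φ : Fin k ⊎ I → Fin k ⊎ J
    φ (inj₁ u) = inj₁ u
    φ (inj₂ i) = inj₂ (ι i)

    pres : ∀ x y → Adj (addVertices H (M ∘ ι)) x y → Adj (addVertices H M) (φ x) (φ y)
    pres (inj₁ _) (inj₁ _) a = a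
    pres (inj₁ _) (inj₂ _) a = a
    pres (inj₂ _) (inj₁ _) a = a

  Blocking⇒Ramsey : {M : J → Subset k} → Blocking M → Ramsey (addVertices H M)
  Blocking⇒Ramsey {M = M} blocking d with monoTriangle? any? (pullback (old-vertices {M = M}) d)
  ... | yes t    = push-triangle (old-vertices {M = M}) d t
  -- Pulled back to `addVertex H (M j)`, `d` extends its own restriction to `H`, so it cannot be
  -- free there.
  ... | no free with j , ¬ext ← blocking (pullback (old-vertices {M = M}) d) free =
    push-triangle new d (decidable-stable (monoTriangle? any-⊎𝟙? (pullback new d))
      λ free′ → ¬ext (pullback new d , (λ _ _ _ → refl) , free′))
    where
    new : Hom (addVertex H (M j)) (addVertices H M)
    new = reindex {M = M} (λ _ → j)

  -- Extensions to each new vertex separately would glue to a free colouring of the whole graph.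
  -- Finiteness of the index set turns this refutation into a concrete `j`.
  Ramsey⇒Blocking : {M : Fin s → Subset k} → Ramsey (addVertices H M) → Blocking M
  Ramsey⇒Blocking {M = M} R c free =
    ¬∀⟶∃¬ _ _ (λ j → extendable? c (M j)) λ ext →
      let f = λ j → Extendable⇒Compatible c (M j) (ext j) in
      glue-free c (proj₁ ∘ f) free (proj₂ ∘ f) (R (glue c (proj₁ ∘ f)))

-- Neighbourhoods of the new vertices in a minimal Ramsey graph

∈⇒T : {M : Subset n} {u : Fin n} → u ∈ M → T (lookup M u)
∈⇒T = Equivalence.from T-≡ ∘ []=⇒lookup

T⇒∈ : {M : Subset n} {u : Fin n} → T (lookup M u) → u ∈ M
T⇒∈ {M = M} {u} = lookup⇒[]= u M ∘ Equivalence.to T-≡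

module _ {H : Graph (Fin k)} {M : Fin s → Subset k}
         (min : MinimalRamsey (addVertices H M)) where

  private
    _≟ⱽ_ : DecidableEquality (Fin k ⊎ Fin s)
    _≟ⱽ_ = ≡-dec _≟_ _≟_

  -- New vertices with equal neighbourhoods would dominate each other.
  neighbourhoods-distinct : Injective _≡_ _≡_ M
  neighbourhoods-distinct {i} {j} Mi≡Mj with i ≟ j
  ... | yes i≡j = i≡j
  ... | no  i≢j = contradiction dom
    (no-dominated-vertex _≟ⱽ_ min (i≢j ∘ inj₂-injective))
    where
    dom : ∀ u → Adj (addVertices H M) (inj₂ i) u → Adj (addVertices H M) (inj₂ j) u
    dom (inj₁ u) = subst (λ S → T (lookup S u)) Mi≡Mj

  -- Otherwise the old vertex `v` would dominate the new vertex `j`.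
  neighbourhood-undominated : ∀ j v → M j ⊈ N H v
  neighbourhood-undominated j v Mj⊆N =
    no-dominated-vertex _≟ⱽ_ min {inj₂ j} {inj₁ v} (λ ()) dom
    where
    dom : ∀ u → Adj (addVertices H M) (inj₂ j) u → Adj (addVertices H M) (inj₁ v) u
    dom (inj₁ u) u∈ =
      subst T (lookup∘tabulate (adj H v) u) (∈⇒T (Mj⊆N (T⇒∈ u∈)))

  -- A blocking subfamily without `j` would give a Ramsey graph mapping into this one and missing
  -- the new vertex `j`.
  ¬Blocking-subfamily : ∀ {I : Set} (ι : I → Fin s) j → (∀ i → ι i ≢ j) →
                        ¬ Blocking {H = H} (M ∘ ι)
  ¬Blocking-subfamily {I} ι j misses blocking =
    hom-surjective _≟ⱽ_ min (Blocking⇒Ramsey blocking)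
      (reindex {M = M} ι) (inj₂ j)
      λ { (inj₁ _) () ; (inj₂ i) e → misses i (inj₂-injective e) }

  -- If `M j` were unmarked, it would block no free colouring, so the index blocking a given
  -- colouring would always differ from `j` and the other sets would already block everything.
  neighbourhood-marked : ∀ j → Marked H (M j)
  neighbourhood-marked j = decidable-stable (marked? (M j)) λ ¬marked →
    ¬Blocking-subfamily {∃[ i ] i ≢ j} proj₁ j proj₂ λ c free →
      let i , ¬ext = Ramsey⇒Blocking (proj₁ min) c free in
      (i , λ { refl → ¬marked (c , free , ¬ext) }) , ¬ext

  neighbourhoods-minimalComplete : MinimalComplete H M
  neighbourhoods-minimalComplete =
    (neighbourhood-marked , Ramsey⇒Blocking (proj₁ min)) ,
    -- Properness of `I` supplies an index `j` that the subfamily omits.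
    λ I (_ , j , _ , j∉I) (_ , blocking) →
      ¬Blocking-subfamily proj₁ j (λ { (i , i∈I) refl → j∉I i∈I }) blocking

-- Colourability

K₅ : Graph (Fin 5)
K₅ = record
  { adj        = λ u v → isNo (u ≟ v)
  ; adj-sym    = λ u v → isNo-sym u v
  ; adj-irrefl = λ v → isNo-refl v
  }
  where
  isNo-sym : (u v : Fin 5) → isNo (u ≟ v) ≡ isNo (v ≟ u)
  isNo-sym u v with u ≟ v | v ≟ u
  ... | yes _   | yes _   = refl
  ... | yes u≡v | no v≢u  = contradiction (sym u≡v) v≢u
  ... | no u≢v  | yes v≡u = contradiction (sym v≡u) u≢v
  ... | no _    | no _    = refl

  isNo-refl : (v : Fin 5) → isNo (v ≟ v) ≡ false
  isNo-refl v with v ≟ v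
  ... | yes _  = refl
  ... | no v≢v = contradiction refl v≢v

-- The colour `true` marks the 5-cycle 0, 1, 2, 3, 4; the remaining edges form another 5-cycle.
-- Neither contains a triangle.
pentagon : EdgeColouring K₅
pentagon = record
  { colour     = λ u v → next u v ∨ next v u
  ; colour-sym = λ u v _ → Bool.∨-comm (next u v) (next v u)
  }
  where
  next : Fin 5 → Fin 5 → Bool
  next u v = suc (toℕ u) % 5 ℕ.≡ᵇ toℕ v

¬Ramsey-K₅ : ¬ Ramsey K₅
-- The type checker evaluates the search over all triples of vertices.
¬Ramsey-K₅ R = toWitnessFalse {a? = monoTriangle? any? pentagon} tt (R pentagon)

-- The new vertices are independent and can share a fifth colour, `zero`; a proper 5-colouring is a
-- homomorphism to `K₅`.
¬4-colourable : {H : Graph (Fin k)} {M : J → Subset k} →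
                Ramsey (addVertices H M) → ¬ Colourable 4 H
¬4-colourable {k = k} {J = J} {H = H} {M = M} R (f , proper) =
  ¬Ramsey-K₅ (Ramsey-hom (hom φ pres) R)
  where
  φ : Fin k ⊎ J → Fin 5
  φ (inj₁ u) = suc (f u)
  φ (inj₂ _) = zero

  pres : ∀ x y → Adj (addVertices H M) x y → Adj K₅ (φ x) (φ y)
  pres (inj₁ u) (inj₁ v) a = fromWitnessFalse (proper u v a ∘ suc-injective)
  pres (inj₁ u) (inj₂ j) _ = tt
  pres (inj₂ j) (inj₁ v) _ = tt

Colourable-mono : (G : Graph V) → r ≤ r′ → Colourable r G → Colourable r′ G
Colourable-mono _ r≤r′ (f , proper) =
  (λ v → inject≤ (f v) r≤r′) ,
  λ u v a → proper u v a ∘ inject≤-injective r≤r′ r≤r′ (f u) (f v)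

¬Colourable⇒<χ : (G : Graph (Fin n)) → ¬ Colourable r G → r < χ G
¬Colourable⇒<χ {n} {r} G ¬col = v≤min⁺
  -- The default value `n` of the minimum is covered by the identity colouring.
  (bound (id , λ { u .u a refl → irreflexive G a }))
  (All.map bound (all-filter (colourable? G) (upTo (suc n))))
  where
  bound : ∀ {m} → Colourable m G → r < m
  bound col = ≰⇒> λ m≤r → ¬col (Colourable-mono G m≤r col)

-- Clique and independence numbers

ContainsK-antimono : {G : Graph V} → r ≤ r′ → ContainsK r′ G → ContainsK r G
ContainsK-antimono r≤r′ (f , clique) =
  (λ i → f (inject≤ i r≤r′)) ,
  λ i j i≢j → clique _ _ (i≢j ∘ inject≤-injective r≤r′ r≤r′ i j)

ContainsK⇒≤ : {G : Graph (Fin n)} → ContainsK r G → r ≤ n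
ContainsK⇒≤ {G = G} (f , clique) = injective⇒≤ {f = f} injective
  where
  injective : Injective _≡_ _≡_ f
  injective {i} {j} fi≡fj with i ≟ j
  ... | yes i≡j = i≡j
  ... | no i≢j  = contradiction (subst (λ x → Adj G x (f j)) fi≡fj (clique i j i≢j))
                                (irreflexive G)

ContainsK⇒≤ω : (G : Graph (Fin n)) → ContainsK r G → r ≤ ω G
ContainsK⇒≤ω G K = All.lookup (xs≤max 0 _)
  -- The clique size is at most `n`, so it falls within the searched range.
  (∈-filter⁺ (containsK? G) (∈-upTo⁺ (s≤s (ContainsK⇒≤ {G = G} K))) K)

-- The hypothesis `1 ≤ r` keeps the default value 0 of the maximum below `r`.
¬ContainsK⇒ω< : (G : Graph (Fin n)) → 1 ≤ r → ¬ ContainsK r G → ω G < r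
¬ContainsK⇒ω< {n} G 1≤r ¬K = max<v⁺ 1≤r
  (All.map (λ K → ≰⇒> λ r≤m → ¬K (ContainsK-antimono {G = G} r≤m K))
           (all-filter (containsK? G) (upTo (suc n))))

HasIndependent-antimono : {G : Graph V} → r ≤ r′ → HasIndependent r′ G → HasIndependent r G
HasIndependent-antimono r≤r′ (f , injective , indep) =
  (λ i → f (inject≤ i r≤r′)) ,
  (λ {i} {j} → inject≤-injective r≤r′ r≤r′ i j ∘ injective) ,
  λ i j → indep _ _

HasIndependent⇒≤α : (G : Graph (Fin n)) → HasIndependent r G → r ≤ α G
HasIndependent⇒≤α G I@(_ , injective , _) = All.lookup (xs≤max 0 _)
  (∈-filter⁺ (hasIndependent? G) (∈-upTo⁺ (s≤s (injective⇒≤ injective))) I)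

≤α⇒HasIndependent : (G : Graph (Fin n)) → r ≤ α G → HasIndependent r G
≤α⇒HasIndependent {n} G r≤α = HasIndependent-antimono {G = G} r≤α
  -- The maximum is an entry of the list or the default 0, which the empty set realises.
  (argmax-all id {P = λ m → HasIndependent m G} {⊥ = 0}
    ((λ ()) , (λ { {()} }) , λ ()) (all-filter (hasIndependent? G) (upTo (suc n))))

-- The new vertex `j` is adjacent to all of `M j`, so it enlarges any clique there; condition (a)
-- thus follows from a bound on the cliques of the whole graph.
cone-clique : {H : Graph (Fin k)} {M : J → Subset k} (j : J) →
              ContainsK r (H [ M j ]) → ContainsK (suc r) (addVertices H M)
cone-clique {k = k} {J = J} {r = r} {H = H} {M = M} j (f , clique) = g , g-clique
  where
  g : Fin (suc r) → Fin k ⊎ J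
  g zero    = inj₂ j
  g (suc i) = inj₁ (proj₁ (f i))

  g-clique : ∀ x y → x ≢ y → Adj (addVertices H M) (g x) (g y)
  g-clique zero    zero    x≢y = contradiction refl x≢y
  g-clique zero    (suc y) _   = ∈⇒T (proj₂ (f y))
  g-clique (suc x) zero    _   = ∈⇒T (proj₂ (f x))
  g-clique (suc x) (suc y) x≢y = clique x y (x≢y ∘ cong suc)

-- A clique contains at most one new vertex.
clique-cases : {H : Graph (Fin k)} {M : J → Subset k} →
               ContainsK (suc r) (addVertices H M) →
               ContainsK (suc r) H ⊎ ∃[ j ] ContainsK r (H [ M j ])
clique-cases {k = k} {J = J} {r = r} {H = H} {M = M} (f , clique)
  with any? (λ i → new? (f i))
  where
  New : Fin k ⊎ J → Set
  New x = ∃[ j ] x ≡ inj₂ j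

  new? : ∀ x → Dec (New x)
  new? (inj₁ _) = no λ ()
  new? (inj₂ j) = yes (j , refl)
... | yes (i , j , fi≡j) = inj₂ (j , proj₁ ∘ rest , λ x y x≢y →
        subst₂ (Adj (addVertices H M)) (proj₂ (rest x)) (proj₂ (rest y))
               (clique _ _ (x≢y ∘ punchIn-injective i x y)))
  where
  rest : ∀ x → Σ (∃[ u ] u ∈ M j) λ u → f (punchIn i x) ≡ inj₁ (proj₁ u)
  -- Each other clique vertex is adjacent to the new vertex `j`, hence is old and lies in `M j`.
  rest x with f (punchIn i x) | clique i (punchIn i x) (punchInᵢ≢i i x ∘ sym)
  ... | inj₁ u | a = (u , T⇒∈ (subst (λ y → Adj (addVertices H M) y (inj₁ u)) fi≡j a)) , refl
  ... | inj₂ l | a =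
    contradiction (subst (λ y → Adj (addVertices H M) y (inj₂ l)) fi≡j a) λ ()
... | no ¬new = inj₁ (proj₁ ∘ old , λ x y x≢y →
        subst₂ (Adj (addVertices H M)) (proj₂ (old x)) (proj₂ (old y)) (clique x y x≢y))
  where
  old : ∀ x → ∃[ u ] f x ≡ inj₁ u
  old x with f x in e
  ... | inj₁ u = u , refl
  ... | inj₂ j = contradiction (x , j , e) ¬new

-- Splitting off an independent set

-- Induction on `s`: remove `zero` from the domain and `f zero` from the codomain, extend the rest,
-- and reinsert the pair.
extend-to-permutation : ∀ s k (f : Fin s → Fin (s + k)) → Injective _≡_ _≡_ f →
                        Σ (Permutation′ (s + k)) λ π → ∀ i → π ⟨$⟩ʳ (i ↑ˡ k) ≡ f i
extend-to-permutation zero    k f _ = Perm.id , λ ()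
extend-to-permutation (suc s) k f injective = insert zero (f zero) π , agrees
  where
  f₀≢ : ∀ i → f zero ≢ f (suc i)
  f₀≢ i e = 0≢1+n (injective e)

  ih = extend-to-permutation s k (λ i → punchOut (f₀≢ i))
    λ {i} {j} → suc-injective ∘ injective ∘ punchOut-injective (f₀≢ i) (f₀≢ j)

  π = proj₁ ih

  agrees : ∀ i → insert zero (f zero) π ⟨$⟩ʳ (i ↑ˡ k) ≡ f i
  agrees zero    = refl
  agrees (suc i) = trans (insert-punchIn zero (f zero) π (i ↑ˡ k))
    (trans (cong (punchIn (f zero)) (proj₂ ih i)) (punchIn-punchOut (f₀≢ i)))

split-independent : (G : Graph (Fin n)) → n ≡ s + k → HasIndependent s G →
                    Σ (Graph (Fin k)) λ H → Σ (Fin s → Subset k) λ M → addVertices H M ≅ G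
split-independent {s = s} {k = k} G refl (f , injective , indep) =
  H , M , record { bij = ψ ; adj-pres = pres }
  where
  π = extend-to-permutation s k f injective

  ψ : (Fin k ⊎ Fin s) ↔ Fin (s + k)
  -- The summands are swapped so that the new vertex `j` sits at `j ↑ˡ k`, which the permutation
  -- sends to `f j`.
  ψ = (proj₁ π ↔-∘ ↔-sym +↔⊎) ↔-∘ ⊎-comm _ _

  open Inverse ψ using (to)

  H : Graph (Fin k)
  H = record
    { adj        = λ u v → adj G (to (inj₁ u)) (to (inj₁ v))
    ; adj-sym    = λ u v → adj-sym G _ _
    ; adj-irrefl = λ v → adj-irrefl G _
    }

  M : Fin s → Subset k
  M j = tabulate (λ u → adj G (to (inj₁ u)) (to (inj₂ j)))

  pres : ∀ x y → adj (addVertices H M) x y ≡ adj G (to x) (to y)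
  pres (inj₁ u) (inj₁ v) = refl
  pres (inj₁ u) (inj₂ j) = lookup∘tabulate _ u
  pres (inj₂ j) (inj₁ v) = trans (lookup∘tabulate _ v) (adj-sym G _ _)
  pres (inj₂ i) (inj₂ j) = sym (¬-not λ e → indep i j
    (subst₂ (Adj G) (proj₂ π i) (proj₂ π j) (Equivalence.from T-≡ e)))

-- The two inclusions

theorem3p10 : (q k : ℕ) → 1 ≤ q → 1 ≤ k → (n : ℕ) (G : Graph (Fin n)) → ℬ q k G ⇔ (MinimalRamsey G × ω G < q × α G ≥ n ∸ k × n ∸ k ≥ 1)
theorem3p10 (suc q) k 1≤q 1≤k n G = mk⇔ sound exhaustive
  where
  sound : ℬ (suc q) k G → MinimalRamsey G × ω G < suc q × α G ≥ n ∸ k × n ∸ k ≥ 1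
  sound (D , G≅D , min) =
    MinimalRamsey-≅ D≅G min ,
    -- A clique on `suc q` vertices lies in `H` or leaves one on `q` vertices inside some `M j`; `𝒜`
    -- excludes the former and condition (a) the latter.
    ¬ContainsK⇒ω< G 1≤q ([ ¬K-H , (λ (j , K) → proj₁ (M∈ℳ j) K) ]′ ∘ clique-cases
                          ∘ ContainsK-hom (≅⇒Hom G≅D)) ,
    subst (_≤ α G) (sym n∸k≡t) (HasIndependent⇒≤α G independent) ,
    subst (1 ≤_) (sym n∸k≡t) nonempty
    where
    open Datum D renaming (s to t)
    D≅G = ≅-sym G≅D
    open _≅_ D≅G
    open Inverse bij

    ¬K-H : ¬ ContainsK (suc q) H
    ¬K-H K = <⇒≱ (proj₁ H∈𝒜) (ContainsK⇒≤ω H K)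

    -- Counting vertices along the isomorphism gives `n` as `k + t`.
    n∸k≡t : n ∸ k ≡ t
    n∸k≡t = trans (cong (_∸ k) (↔⇒≡ (↔-sym (bij ↔-∘ +↔⊎)))) (m+n∸m≡n k t)

    independent : HasIndependent t G
    independent = to ∘ inj₂ ,
      inj₂-injective ∘ Injection.injective (↔⇒↣ bij) ,
      λ i j → subst T (sym (adj-pres (inj₂ i) (inj₂ j)))

  exhaustive : MinimalRamsey G × ω G < suc q × α G ≥ n ∸ k × n ∸ k ≥ 1 → ℬ (suc q) k G
  exhaustive (min , ω<q , α≥ , 1≤n∸k) = D , ≅-sym D≅G , minD
    where
    -- As `n ∸ k` is positive, the subtraction is not truncated, and `n` splits as `(n ∸ k) + k`.
    k≤n : k ≤ n
    k≤n = <⇒≤ (m∸n≢0⇒n<m (>⇒≢ 1≤n∸k))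

    parts = split-independent {s = n ∸ k} {k = k} G (sym (m∸n+n≡m k≤n)) (≤α⇒HasIndependent G α≥)

    H = proj₁ parts
    M = proj₁ (proj₂ parts)
    D≅G = proj₂ (proj₂ parts)

    minD : MinimalRamsey (addVertices H M)
    minD = MinimalRamsey-≅ (≅-sym D≅G) min

    ¬K-D : ¬ ContainsK (suc q) (addVertices H M)
    ¬K-D K = <⇒≱ ω<q (ContainsK⇒≤ω G (ContainsK-hom (≅⇒Hom D≅G) K))

    D : Datum (suc q) k
    D = record
      { H        = H
      ; H∈𝒜      = ¬ContainsK⇒ω< H 1≤q (¬K-D ∘ ContainsK-hom (old-vertices {M = M}))
                 , ¬Colourable⇒<χ H (¬4-colourable {M = M} (proj₁ minD))
      ; s        = n ∸ k
      ; nonempty = 1≤n∸k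
      ; M        = M
      ; distinct = neighbourhoods-distinct minD
      ; M∈ℳ      = λ j → ¬K-D ∘ cone-clique j
                       , neighbourhood-undominated minD j
                       , neighbourhood-marked minD j
      ; minimal  = neighbourhoods-minimalComplete minD
      }
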